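{- Suppose $d,k,n$ are positive integers with $d+1\ge k\ge 2$. Then \[\chi^k_d(P_n)=\left\lceil\frac{\min(d+1,n)}{k-1}\right\rceil .\] Furthermore, \[\chi^k_d(P_\infty)=\left\lceil\frac{d+1}{k-1}\right\rceil .\]
   Context: $P_n$ is the path graph on $n$ vertices $\{1,\dots,n\}$ (consecutive integers adjacent), and $P_\infty$ is the two-way infinite path with vertex set $\mathbb Z$ (consecutive integers adjacent). A shortest path in a graph $G$ is a path between some vertices $u,v$ whose length (number of edges) equals the graph distance between $u$ and $v$. A set $S\subseteq V(G)$ is $k,d$-independent in $G$ if every shortest path in $G$ of length at most $d$ contains fewer than $k$ vertices of $S$. The $k,d$-chromatic number $\chi^k_d(G)$ is the least positive integer $c$ such that some coloring $V(G)\to\{1,\dots,c\}$ has all color classes $k,d$-independent. -}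

module Defs where

open import Data.Fin using (Fin; toℕ)
import Data.Fin.Properties as Fin
open import Data.Integer as ℤ using (ℤ; +_)
import Data.Integer.Properties as ℤ
open import Data.List as List using (List; []; _∷_; filter)
open import Data.List.Relation.Unary.Unique.Propositional using (Unique)
open import Data.Nat using (ℕ; zero; suc; _∸_; _≤_; _<_; NonZero; s≤s)
open import Data.Nat.Properties using (1+n≢n)
import Data.Rational.Unnormalised as ℚᵘ
open import Data.Product using (_×_; Σ-syntax; ∃-syntax)
open import Data.Sum using (_⊎_; inj₁; inj₂; swap)
open import Level using (0ℓ)
open import Relation.Binary using (Rel; Symmetric; Irreflexive)
open import Relation.Binary.Construct.Closure.ReflexiveTransitive using (Star; ε; _◅_)
open import Relation.Binary.PropositionalEquality using (_≡_; refl; sym)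
open import Relation.Unary using (Pred; Decidable)

record Graph : Set₁ where
  field
    Vertex     : Set
    Adj        : Rel Vertex 0ℓ
    adj-sym    : Symmetric Adj
    adj-irrefl : Irreflexive _≡_ Adj

module _ (G : Graph) where
  open Graph G

  Walk : Rel Vertex 0ℓ
  Walk = Star Adj

  vertices : ∀ {u v} → Walk u v → List Vertex
  vertices {u} ε       = u ∷ []
  vertices {u} (_ ◅ p) = u ∷ vertices p

  edgeCount : ∀ {u v} → Walk u v → ℕ
  edgeCount ε       = 0
  edgeCount (_ ◅ p) = suc (edgeCount p)

  IsPath : ∀ {u v} → Walk u v → Set
  IsPath p = Unique (vertices p)

  -- A relation rather than a function: in an arbitrary graph the distance
  -- need not be computable (nor defined, when there is no path from u to v).
  IsDistance : Vertex → Vertex → ℕ → Set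
  IsDistance u v m =
    (Σ[ p ∈ Walk u v ] IsPath p × edgeCount p ≡ m) ×
    (∀ (p : Walk u v) → IsPath p → m ≤ edgeCount p)

  IsShortestPath : ∀ {u v} → Walk u v → Set
  IsShortestPath {u} {v} p = IsPath p × IsDistance u v (edgeCount p)

  -- Decidability of S is what allows its elements to be counted.  A path does
  -- not repeat vertices, so the filtered list has one entry for each vertex of
  -- the path that lies in S.
  Independent : (k d : ℕ) {S : Pred Vertex 0ℓ} → Decidable S → Set
  Independent k d S? =
    ∀ {u v} (p : Walk u v) → IsShortestPath p → edgeCount p ≤ d →
    List.length (filter S? (vertices p)) < k

  IsColoring : (k d : ℕ) {c : ℕ} → (Vertex → Fin c) → Set
  IsColoring k d f = ∀ i → Independent k d (λ v → f v Fin.≟ i)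

  Colorable : (k d c : ℕ) → Set
  Colorable k d c = ∃[ f ] IsColoring k d {c} f

  IsChromaticNumber : (k d c : ℕ) → Set
  IsChromaticNumber k d c =
    1 ≤ c × Colorable k d c × (∀ c′ → 1 ≤ c′ → Colorable k d c′ → c ≤ c′)

-- The vertices 1, …, n are represented by Fin n, i.e. shifted to 0, …, n - 1.
pathGraph : ℕ → Graph
pathGraph n = record
  { Vertex     = Fin n
  ; Adj        = λ i j → suc (toℕ i) ≡ toℕ j ⊎ suc (toℕ j) ≡ toℕ i
  ; adj-sym    = swap
  ; adj-irrefl = λ { refl (inj₁ e) → 1+n≢n e ; refl (inj₂ e) → 1+n≢n e }
  }

infinitePath : Graph
infinitePath = record
  { Vertex     = ℤ
  ; Adj        = λ i j → ℤ.suc i ≡ j ⊎ ℤ.suc j ≡ i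
  ; adj-sym    = swap
  ; adj-irrefl = λ { refl (inj₁ e) → ℤ.i≢suc[i] (sym e) ; refl (inj₂ e) → ℤ.i≢suc[i] (sym e) }
  }

⌈_/_⌉ : (m n : ℕ) .{{_ : NonZero n}} → ℤ
⌈ m / n ⌉ = ℚᵘ.ceiling (+ m ℚᵘ./ n)

k∸1-nonZero : ∀ {k} → 2 ≤ k → NonZero (k ∸ 1)
k∸1-nonZero (s≤s (s≤s _)) = _

{-# OPTIONS --safe #-}

-- Let m = d + 1 for the infinite path and m = min (d + 1) n for P_n, and q = k - 1.
-- A path with at most d edges has at most m vertices, and any two of its
-- vertices are at distance less than m; so its vertices are pairwise
-- incongruent modulo m, and colouring v by (v mod m) / q gives each colour to
-- at most q of them.  Conversely m consecutive vertices form a shortest path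
-- with at most d edges, and c colours cover at most c * q of its vertices.

module Submission where

open import Defs
open import Data.Fin as Fin using (Fin; toℕ; fromℕ<)
import Data.Fin.Properties as Fin
open import Data.Integer as ℤ using (ℤ; +_; ∣_∣)
import Data.Integer.DivMod as ℤ
import Data.Integer.Properties as ℤ
open import Data.Integer.Tactic.RingSolver using (solve-∀)
open import Data.List using (List; []; _∷_; filter; length; lookup)
open import Data.List.Membership.Propositional using (_∈_; _∉_)
open import Data.List.Membership.Propositional.Properties using (∈-filter⁻; ∈-lookup)
open import Data.List.Properties using (filter-all; filter-none)
import Data.List.Relation.Unary.All as All
import Data.List.Relation.Unary.All.Properties as All
open import Data.List.Relation.Unary.AllPairs using ([]; _∷_)
open import Data.List.Relation.Unary.Any using (here; there)
open import Data.List.Relation.Unary.Unique.Propositional using (Unique)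
import Data.List.Relation.Unary.Unique.Propositional.Properties as Unique
open import Data.Nat
  using (ℕ; zero; suc; _+_; _*_; _∸_; _⊓_; _/_; _%_; _≤_; _<_; NonZero; z≤n; s≤s; s≤s⁻¹)
open import Data.Nat.DivMod using (m≡m%n+[m/n]*n; m%n<n; m<n*o⇒m/o<n)
open import Data.Nat.Properties
open import Data.Product using (_×_; _,_; proj₁; proj₂; ∃-syntax; Σ-syntax)
open import Data.Sum using (_⊎_; inj₁; inj₂)
open import Function using (_⇔_; mk⇔; Equivalence; id; _∘_)
open import Level using (0ℓ)
open import Relation.Binary.Construct.Closure.ReflexiveTransitive using (ε; _◅_)
open import Relation.Binary.PropositionalEquality
  using (_≡_; refl; sym; trans; cong; subst; module ≡-Reasoning)
open import Relation.Nullary using (yes; no; contradiction)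
open import Relation.Unary using (Pred; Decidable)

-- Ceilings of quotients of natural numbers.

ceiling-exact : ∀ m q .{{_ : NonZero q}} → suc m % q ≡ 0 → ⌈ suc m / q ⌉ ≡ + (suc m / q)
-- The ceiling is the negated floor of the negated fraction, and dividing a negative numerator
-- branches on whether this remainder vanishes.
ceiling-exact m q@(suc _) eq with suc m % q
... | zero = trans (cong ℤ.-_ (ℤ.*-identityˡ (ℤ.- + (suc m / q)))) (ℤ.neg-involutive (+ (suc m / q)))

ceiling-inexact : ∀ m q {r} .{{_ : NonZero q}} → suc m % q ≡ suc r → ⌈ suc m / q ⌉ ≡ + suc (suc m / q)
ceiling-inexact m q@(suc _) eq with suc m % q
... | suc _ = cong ℤ.-_ (ℤ.*-identityˡ ℤ.-[1+ suc m / q ])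

-- This adjunction is all that is used about ceilings: both bounds on the number of colours can then
-- be stated as `m ≤ b * q`.
⌈/⌉-galois : ∀ m q .{{_ : NonZero q}} →
  ∃[ c ] (+ c ≡ ⌈ m / q ⌉ × (∀ b → c ≤ b ⇔ m ≤ b * q))
⌈/⌉-galois zero (suc _) = 0 , refl , λ _ → mk⇔ (λ _ → z≤n) (λ _ → z≤n)
⌈/⌉-galois (suc m) q with suc m % q in eq
... | zero = t , sym (ceiling-exact m q eq) , λ b → mk⇔
    (λ t≤b → ≤-trans (≤-reflexive m≡tq) (*-monoˡ-≤ q t≤b))
    (λ m≤bq → *-cancelʳ-≤ t b q (≤-trans (≤-reflexive (sym m≡tq)) m≤bq))
  where
  t = suc m / q
  m≡tq : suc m ≡ t * q
  m≡tq = trans (m≡m%n+[m/n]*n (suc m) q) (cong (_+ t * q) eq)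
... | suc r = suc t , sym (ceiling-inexact m q eq) , λ b → mk⇔
    (λ t<b → ≤-trans m≤[1+t]q (*-monoˡ-≤ q t<b))
    (λ m≤bq → *-cancelʳ-< q t b (<-≤-trans tq<m m≤bq))
  where
  t = suc m / q
  m≡ : suc m ≡ suc r + t * q
  m≡ = trans (m≡m%n+[m/n]*n (suc m) q) (cong (_+ t * q) eq)
  m≤[1+t]q : suc m ≤ suc t * q
  m≤[1+t]q = ≤-trans (≤-reflexive m≡)
    (+-monoˡ-≤ (t * q) (<⇒≤ (subst (_< q) eq (m%n<n (suc m) q))))
  tq<m : t * q < suc m
  tq<m = subst (t * q <_) (sym m≡) (s≤s (m≤n+m (t * q) r))

-- Distances and residues in the integers.

∣i-k∣≤∣i-j∣+∣j-k∣ : ∀ i j k → ∣ i ℤ.- k ∣ ≤ ∣ i ℤ.- j ∣ + ∣ j ℤ.- k ∣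
∣i-k∣≤∣i-j∣+∣j-k∣ i j k = subst (λ x → ∣ x ∣ ≤ ∣ i ℤ.- j ∣ + ∣ j ℤ.- k ∣) (split i j k)
  (ℤ.∣i+j∣≤∣i∣+∣j∣ (i ℤ.- j) (j ℤ.- k))
  where
  split : ∀ i j k → (i ℤ.- j) ℤ.+ (j ℤ.- k) ≡ i ℤ.- k
  split = solve-∀

∣i-i∣≡0 : ∀ i → ∣ i ℤ.- i ∣ ≡ 0
∣i-i∣≡0 i = cong ∣_∣ (ℤ.+-inverseʳ i)

-- Equal remainders cancel in `i - j`, leaving a multiple of `m`; being smaller than `m` in absolute
-- value, it is zero.
%ℕ-injective-near : ∀ m .{{_ : NonZero m}} {i j} → ∣ i ℤ.- j ∣ < m →
  i ℤ.%ℕ m ≡ j ℤ.%ℕ m → i ≡ j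
%ℕ-injective-near m {i} {j} near eq = ℤ.i-j≡0⇒i≡j i j (ℤ.∣i∣≡0⇒i≡0 ∣i-j∣≡0)
  where
  a = i ℤ./ℕ m
  b = j ℤ./ℕ m
  factor : ∀ r a b m → (r ℤ.+ a ℤ.* m) ℤ.- (r ℤ.+ b ℤ.* m) ≡ (a ℤ.- b) ℤ.* m
  factor = solve-∀
  open ≡-Reasoning
  ∣i-j∣≡ : ∣ i ℤ.- j ∣ ≡ ∣ a ℤ.- b ∣ * m
  ∣i-j∣≡ = begin
    ∣ i ℤ.- j ∣
      ≡⟨ cong (λ x → ∣ x ℤ.- j ∣) (ℤ.a≡a%ℕn+[a/ℕn]*n i m) ⟩
    ∣ (+ (i ℤ.%ℕ m) ℤ.+ a ℤ.* + m) ℤ.- j ∣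
      ≡⟨ cong (λ x → ∣ (+ (i ℤ.%ℕ m) ℤ.+ a ℤ.* + m) ℤ.- x ∣) (ℤ.a≡a%ℕn+[a/ℕn]*n j m) ⟩
    ∣ (+ (i ℤ.%ℕ m) ℤ.+ a ℤ.* + m) ℤ.- (+ (j ℤ.%ℕ m) ℤ.+ b ℤ.* + m) ∣
      ≡⟨ cong (λ r → ∣ (+ (i ℤ.%ℕ m) ℤ.+ a ℤ.* + m) ℤ.- (+ r ℤ.+ b ℤ.* + m) ∣) (sym eq) ⟩
    ∣ (+ (i ℤ.%ℕ m) ℤ.+ a ℤ.* + m) ℤ.- (+ (i ℤ.%ℕ m) ℤ.+ b ℤ.* + m) ∣
      ≡⟨ cong ∣_∣ (factor (+ (i ℤ.%ℕ m)) a b (+ m)) ⟩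
    ∣ (a ℤ.- b) ℤ.* + m ∣
      ≡⟨ ℤ.abs-* (a ℤ.- b) (+ m) ⟩
    ∣ a ℤ.- b ∣ * m ∎
  ∣a-b∣≡0 : ∣ a ℤ.- b ∣ ≡ 0
  ∣a-b∣≡0 = n<1⇒n≡0 (*-cancelʳ-< m ∣ a ℤ.- b ∣ 1
    (subst (∣ a ℤ.- b ∣ * m <_) (sym (*-identityˡ m)) (subst (_< m) ∣i-j∣≡ near)))
  ∣i-j∣≡0 : ∣ i ℤ.- j ∣ ≡ 0
  ∣i-j∣≡0 = trans ∣i-j∣≡ (cong (_* m) ∣a-b∣≡0)

-- Counting entries of lists.

module _ {A : Set} where

  lookup-injective : ∀ {xs : List A} → Unique xs → ∀ {i j} → lookup xs i ≡ lookup xs j → i ≡ j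
  lookup-injective (_ ∷ _)    {Fin.zero}  {Fin.zero}  _  = refl
  lookup-injective (x∉ ∷ _)   {Fin.zero}  {Fin.suc j} eq = contradiction eq (All.lookup x∉ (∈-lookup j))
  lookup-injective (x∉ ∷ _)   {Fin.suc i} {Fin.zero}  eq = contradiction (sym eq) (All.lookup x∉ (∈-lookup i))
  lookup-injective (_ ∷ uniq) {Fin.suc _} {Fin.suc _} eq = cong Fin.suc (lookup-injective uniq eq)

  length≤-injective : ∀ {q} {xs : List A} → Unique xs → (h : A → Fin q) →
    (∀ {x y} → x ∈ xs → y ∈ xs → h x ≡ h y → x ≡ y) → length xs ≤ q
  length≤-injective {xs = xs} uniq h inj = Fin.injective⇒≤ {f = h ∘ lookup xs}
    (λ eq → lookup-injective uniq (inj (∈-lookup _) (∈-lookup _) eq))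

  length-filter-⊎ : ∀ {P Q R : Pred A 0ℓ} (P? : Decidable P) (Q? : Decidable Q) (R? : Decidable R) →
    (∀ {x} → P x → Q x ⊎ R x) → ∀ xs →
    length (filter P? xs) ≤ length (filter Q? xs) + length (filter R? xs)
  length-filter-⊎ P? Q? R? P⊆Q⊎R [] = z≤n
  length-filter-⊎ P? Q? R? P⊆Q⊎R (x ∷ xs)
    with length-filter-⊎ P? Q? R? P⊆Q⊎R xs | P? x | Q? x | R? x
  ... | ih | yes p | yes _ | yes _ = s≤s (≤-trans ih (+-monoʳ-≤ _ (n≤1+n _)))
  ... | ih | yes p | yes _ | no _  = s≤s ih
  ... | ih | yes p | no _  | yes _ = ≤-trans (s≤s ih) (≤-reflexive (sym (+-suc _ _)))
  ... | ih | yes p | no ¬q | no ¬r with P⊆Q⊎R p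
  ...   | inj₁ q = contradiction q ¬q
  ...   | inj₂ r = contradiction r ¬r
  length-filter-⊎ P? Q? R? P⊆Q⊎R (x ∷ xs) | ih | no _ | yes _ | yes _ =
    m≤n⇒m≤1+n (≤-trans ih (+-monoʳ-≤ _ (n≤1+n _)))
  length-filter-⊎ P? Q? R? P⊆Q⊎R (x ∷ xs) | ih | no _ | yes _ | no _  = m≤n⇒m≤1+n ih
  length-filter-⊎ P? Q? R? P⊆Q⊎R (x ∷ xs) | ih | no _ | no _  | yes _ =
    ≤-trans ih (+-monoʳ-≤ _ (n≤1+n _))
  length-filter-⊎ P? Q? R? P⊆Q⊎R (x ∷ xs) | ih | no _ | no _  | no _  = ih

  -- Induction on a bound `b` for the colours counted: those below `b + 1` are `b` itself, with at
  -- most `q` entries, and those below `b`. At `b = c` the filter keeps every entry.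
  length≤colours*classSize : ∀ {c q} (f : A → Fin c) xs →
    (∀ i → length (filter (λ x → f x Fin.≟ i) xs) ≤ q) → length xs ≤ c * q
  length≤colours*classSize {c} {q} f xs small = subst (λ ys → length ys ≤ c * q)
    (filter-all (λ x → toℕ (f x) <? c) (All.universal (Fin.toℕ<n ∘ f) xs))
    (below c ≤-refl)
    where
    below : ∀ b → b ≤ c → length (filter (λ x → toℕ (f x) <? b) xs) ≤ b * q
    below zero    _   = ≤-reflexive (cong length
      (filter-none (λ x → toℕ (f x) <? 0) (All.universal (λ _ → n≮0) xs)))
    below (suc b) b<c = ≤-trans
      (length-filter-⊎ (λ x → toℕ (f x) <? suc b) (λ x → f x Fin.≟ fromℕ< b<c)
        (λ x → toℕ (f x) <? b) split xs)
      (+-mono-≤ (small (fromℕ< b<c)) (below b (<⇒≤ b<c)))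
      where
      split : ∀ {x} → toℕ (f x) < suc b → f x ≡ fromℕ< b<c ⊎ toℕ (f x) < b
      split (s≤s fx≤b) with m≤n⇒m<n∨m≡n fx≤b
      ... | inj₁ fx<b = inj₂ fx<b
      ... | inj₂ fx≡b = inj₁ (Fin.toℕ-injective (trans fx≡b (sym (Fin.toℕ-fromℕ< b<c))))

-- Graphs placed injectively on the integer line.

length-vertices : ∀ G {u v} (p : Walk G u v) → length (vertices G p) ≡ suc (edgeCount G p)
length-vertices G ε       = refl
length-vertices G (_ ◅ p) = cong suc (length-vertices G p)

-- The common ground of the finite and infinite paths: each edge moves the position by at most one,
-- so position differences bound walk lengths from below.
module PathLike (G : Graph) (pos : Graph.Vertex G → ℤ)
  (pos-injective : ∀ {u v} → pos u ≡ pos v → u ≡ v)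
  (pos-adj : ∀ {u v} → Graph.Adj G u v → ∣ pos u ℤ.- pos v ∣ ≤ 1) where

  open Graph G

  dist : Vertex → Vertex → ℕ
  dist u v = ∣ pos u ℤ.- pos v ∣

  dist-step : ∀ {u u′} v → Adj u u′ → dist u v ≤ suc (dist u′ v)
  dist-step {u} {u′} v a = ≤-trans (∣i-k∣≤∣i-j∣+∣j-k∣ (pos u) (pos u′) (pos v))
    (+-monoˡ-≤ _ (pos-adj a))

  dist-start : ∀ {u v w} (p : Walk G u v) → w ∈ vertices G p → dist u w ≤ edgeCount G p
  dist-start {u} ε       (here refl) = ≤-reflexive (∣i-i∣≡0 (pos u))
  dist-start {u} (_ ◅ _) (here refl) = ≤-trans (≤-reflexive (∣i-i∣≡0 (pos u))) z≤n
  dist-start (a ◅ p) (there w∈) = ≤-trans (dist-step _ a) (s≤s (dist-start p w∈))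

  dist-vertices : ∀ {u v x y} (p : Walk G u v) → x ∈ vertices G p → y ∈ vertices G p →
    dist x y ≤ edgeCount G p
  dist-vertices p@ε       (here refl) y∈ = dist-start p y∈
  dist-vertices p@(_ ◅ _) (here refl) y∈ = dist-start p y∈
  dist-vertices {u} {x = x} p@(_ ◅ _) x∈@(there _) (here refl) =
    ≤-trans (≤-reflexive (ℤ.∣i-j∣≡∣j-i∣ (pos x) (pos u))) (dist-start p x∈)
  dist-vertices (_ ◅ p) (there x∈) (there y∈) = m≤n⇒m≤1+n (dist-vertices p x∈ y∈)

  end∈vertices : ∀ {u v} (p : Walk G u v) → v ∈ vertices G p
  end∈vertices ε       = here refl
  end∈vertices (_ ◅ p) = there (end∈vertices p)

  -- If the start recurred in the tail, the tail would contain both ends of the walk, forcing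
  -- `dist u v` to be at most the tail's length. The hypothesis passes to the tail because one edge
  -- lowers the distance by at most one.
  geodesic⇒path : ∀ {u v} (p : Walk G u v) → edgeCount G p ≤ dist u v → IsPath G p
  geodesic⇒path ε _ = All.[] ∷ []
  geodesic⇒path {u} {v} (a ◅ p) e<dist =
    All.¬Any⇒All¬ _ u∉p ∷ geodesic⇒path p (s≤s⁻¹ (≤-trans e<dist (dist-step v a)))
    where
    u∉p : u ∉ vertices G p
    u∉p u∈p = <⇒≱ e<dist (dist-vertices p u∈p (end∈vertices p))

  geodesic⇒shortest : ∀ {u v} (p : Walk G u v) → edgeCount G p ≤ dist u v → IsShortestPath G p
  geodesic⇒shortest p e≤dist = path , (p , path , refl) ,
    λ p′ _ → ≤-trans e≤dist (dist-start p′ (end∈vertices p′))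
    where path = geodesic⇒path p e≤dist

  -- The lower bound: such a walk is a shortest path, so each of the `c` colours occurs at most `q`
  -- times among its vertices.
  colorable⇒ : ∀ {q d c u v} (p : Walk G u v) → edgeCount G p ≤ d → edgeCount G p ≤ dist u v →
    Colorable G (suc q) d c → suc (edgeCount G p) ≤ c * q
  colorable⇒ {q} {c = c} p e≤d e≤dist (f , coloring) = subst (_≤ c * q) (length-vertices G p)
    (length≤colours*classSize f (vertices G p)
      (λ i → s≤s⁻¹ (coloring i p (geodesic⇒shortest p e≤dist) e≤d)))

  -- The upper bound: residues modulo `m` are cut into blocks of `q`. The block is the colour and
  -- `slot` the place inside it; together they fix the residue, hence the vertex within a short
  -- path, so `slot` is injective on each colour class there.
  colorable⇐ : ∀ {q d c m} .{{_ : NonZero q}} .{{_ : NonZero m}} →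
    (∀ {u v} (p : Walk G u v) → IsPath G p → edgeCount G p ≤ d → edgeCount G p < m) →
    m ≤ c * q → Colorable G (suc q) d c
  colorable⇐ {q} {d} {c} {m} short m≤cq = f , coloring
    where
    residue : Vertex → ℕ
    residue v = pos v ℤ.%ℕ m
    f<c : ∀ v → residue v / q < c
    f<c v = m<n*o⇒m/o<n (<-≤-trans (ℤ.n%ℕd<d (pos v) m) m≤cq)
    f : Vertex → Fin c
    f v = fromℕ< (f<c v)
    slot : Vertex → Fin q
    slot v = fromℕ< (m%n<n (residue v) q)
    residue-determined : ∀ {x y} → f x ≡ f y → slot x ≡ slot y → residue x ≡ residue y
    residue-determined {x} {y} fx≡fy sx≡sy = begin
      residue x                                  ≡⟨ m≡m%n+[m/n]*n (residue x) q ⟩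
      residue x % q + residue x / q * q          ≡⟨ cong (_+ _) (Fin.fromℕ<-injective _ _ _ _ sx≡sy) ⟩
      residue y % q + residue x / q * q          ≡⟨ cong (λ t → residue y % q + t * q) (Fin.fromℕ<-injective _ _ _ _ fx≡fy) ⟩
      residue y % q + residue y / q * q          ≡⟨ m≡m%n+[m/n]*n (residue y) q ⟨
      residue y                                  ∎
      where open ≡-Reasoning
    coloring : IsColoring G (suc q) d f
    coloring i p (path , _) e≤d = s≤s (length≤-injective (Unique.filter⁺ _ path) slot inj)
      where
      inj : ∀ {x y} → x ∈ filter (λ v → f v Fin.≟ i) (vertices G p) →
        y ∈ filter (λ v → f v Fin.≟ i) (vertices G p) → slot x ≡ slot y → x ≡ y
      inj x∈ y∈ sx≡sy with ∈-filter⁻ (λ v → f v Fin.≟ i) x∈ | ∈-filter⁻ (λ v → f v Fin.≟ i) y∈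
      ... | x∈p , fx≡i | y∈p , fy≡i = pos-injective (%ℕ-injective-near m
        (≤-<-trans (dist-vertices p x∈p y∈p) (short p path e≤d))
        (residue-determined (trans fx≡i (sym fy≡i)) sx≡sy))

  chromaticNumber : ∀ {q d m u v} .{{_ : NonZero q}} →
    (∀ {u v} (p : Walk G u v) → IsPath G p → edgeCount G p ≤ d → edgeCount G p < m) →
    (p : Walk G u v) → suc (edgeCount G p) ≡ m → edgeCount G p ≤ d → edgeCount G p ≤ dist u v →
    ∃[ c ] (IsChromaticNumber G (suc q) d c × + c ≡ ⌈ m / q ⌉)
  chromaticNumber {q} {m = m} short p refl e≤d e≤dist with ⌈/⌉-galois m q
  ... | c , c≡ , galois = c , (1≤c c c*q , colorable⇐ short c*q ,
      λ b _ colorable → Equivalence.from (galois b) (colorable⇒ p e≤d e≤dist colorable)) , c≡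
    where
    c*q : m ≤ c * q
    c*q = Equivalence.to (galois c) ≤-refl
    -- Here `m` is a successor, so zero colours would give the absurd `m ≤ 0`.
    1≤c : ∀ c → m ≤ c * q → 1 ≤ c
    1≤c (suc _) _ = s≤s z≤n

-- The infinite and finite paths.

∣i-suc[i]∣≡1 : ∀ i → ∣ i ℤ.- ℤ.suc i ∣ ≡ 1
∣i-suc[i]∣≡1 i = cong ∣_∣ (difference i)
  where
  difference : ∀ i → i ℤ.- (+ 1 ℤ.+ i) ≡ ℤ.-[1+ 0 ]
  difference = solve-∀

infinitePath-adj : ∀ {i j} → Graph.Adj infinitePath i j → ∣ i ℤ.- j ∣ ≤ 1
infinitePath-adj {i} (inj₁ refl) = ≤-reflexive (∣i-suc[i]∣≡1 i)
infinitePath-adj {i} {j} (inj₂ refl) =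
  ≤-reflexive (trans (ℤ.∣i-j∣≡∣j-i∣ i j) (∣i-suc[i]∣≡1 j))

pathGraph-adj : ∀ {n} {i j : Fin n} → Graph.Adj (pathGraph n) i j → ∣ + toℕ i ℤ.- + toℕ j ∣ ≤ 1
pathGraph-adj {i = i} {j} (inj₁ eq) = infinitePath-adj {+ toℕ i} {+ toℕ j} (inj₁ (cong +_ eq))
pathGraph-adj {i = i} {j} (inj₂ eq) = infinitePath-adj {+ toℕ i} {+ toℕ j} (inj₂ (cong +_ eq))

infinitePath-ascent : ∀ e a → Σ[ p ∈ Walk infinitePath (+ a) (+ (e + a)) ] edgeCount infinitePath p ≡ e
infinitePath-ascent zero    a = ε , refl
infinitePath-ascent (suc e) a with infinitePath-ascent e (suc a)
... | p , eq rewrite +-suc e a = inj₁ refl ◅ p , cong suc eq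

-- The endpoint `j` is given in advance because its bound `toℕ j < n` keeps every intermediate
-- vertex inside `Fin n`.
pathGraph-ascent : ∀ {n} e (i j : Fin n) → e + toℕ i ≡ toℕ j →
  Σ[ p ∈ Walk (pathGraph n) i j ] edgeCount (pathGraph n) p ≡ e
pathGraph-ascent zero    i j eq with Fin.toℕ-injective eq
... | refl = ε , refl
pathGraph-ascent {n} (suc e) i j eq = inj₁ (sym toℕ-next) ◅ proj₁ rest , cong suc (proj₂ rest)
  where
  next<n : suc (toℕ i) < n
  next<n = ≤-<-trans (≤-trans (s≤s (m≤n+m (toℕ i) e)) (≤-reflexive eq)) (Fin.toℕ<n j)
  toℕ-next : toℕ (fromℕ< next<n) ≡ suc (toℕ i)
  toℕ-next = Fin.toℕ-fromℕ< next<n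
  rest = pathGraph-ascent e (fromℕ< next<n) j
    (trans (cong (_+_ e) toℕ-next) (trans (+-suc e (toℕ i)) eq))

path-edgeCount<n : ∀ {n} {u v : Fin n} (p : Walk (pathGraph n) u v) →
  IsPath (pathGraph n) p → edgeCount (pathGraph n) p < n
path-edgeCount<n {n} p path = subst (_≤ n) (length-vertices (pathGraph n) p)
  (length≤-injective path id (λ _ _ eq → eq))

∣0-e∣≡e : ∀ e → ∣ + 0 ℤ.- + e ∣ ≡ e
∣0-e∣≡e zero    = refl
∣0-e∣≡e (suc _) = refl

infinitePath-chromaticNumber : ∀ d q .{{_ : NonZero q}} →
  ∃[ c ] (IsChromaticNumber infinitePath (suc q) d c × + c ≡ ⌈ (d + 1) / q ⌉)
infinitePath-chromaticNumber d q with infinitePath-ascent d 0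
-- The witness runs from 0 to `d`, so it has `d + 1` vertices.
... | p , eq = chromaticNumber
    (λ _ _ e≤d → ≤-trans (s≤s e≤d) (≤-reflexive (+-comm 1 d)))
    p (trans (cong suc eq) (+-comm 1 d)) (≤-reflexive eq)
    (≤-reflexive (trans eq (sym (trans (∣0-e∣≡e (d + 0)) (+-identityʳ d)))))
  where open PathLike infinitePath id id infinitePath-adj

pathGraph-chromaticNumber : ∀ d q n .{{_ : NonZero q}} .{{_ : NonZero n}} →
  ∃[ c ] (IsChromaticNumber (pathGraph n) (suc q) d c × + c ≡ ⌈ (d + 1) ⊓ n / q ⌉)
pathGraph-chromaticNumber d q n@(suc n-1) = chromaticNumber
    -- Two limits on the vertices of a path: its length gives `d + 1`, and their distinctness in
    -- `Fin n` gives `n`.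
    (λ p path e≤d → ⊓-glb (≤-trans (s≤s e≤d) (≤-reflexive (+-comm 1 d))) (path-edgeCount<n p path))
    -- The witness runs from 0 to `d ⊓ n-1`; its vertex count `suc (d ⊓ n-1)` computes to
    -- `suc d ⊓ n`.
    (proj₁ walk) (trans (cong suc eq) (cong (_⊓ n) (+-comm 1 d)))
    (≤-trans (≤-reflexive eq) (m⊓n≤m d n-1))
    (≤-reflexive (trans eq (sym (trans (∣0-e∣≡e (toℕ j)) toℕ-j))))
  where
  open PathLike (pathGraph n) (+_ ∘ toℕ) (Fin.toℕ-injective ∘ ℤ.+-injective) pathGraph-adj
  j : Fin n
  j = fromℕ< (s≤s (m⊓n≤n d n-1))
  toℕ-j : toℕ j ≡ d ⊓ n-1
  toℕ-j = Fin.toℕ-fromℕ< (s≤s (m⊓n≤n d n-1))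
  walk = pathGraph-ascent (d ⊓ n-1) Fin.zero j (trans (+-identityʳ _) (sym toℕ-j))
  eq = proj₂ walk

theorem4p4 : (d k n : ℕ) → 1 ≤ d → 1 ≤ k → 1 ≤ n →
    k ≤ d + 1 → (2≤k : 2 ≤ k) →
    let instance _ = k∸1-nonZero 2≤k in
    (∃[ c ] (IsChromaticNumber (pathGraph n) k d c × + c ≡ ⌈ (d + 1) ⊓ n / (k ∸ 1) ⌉))
    × (∃[ c ] (IsChromaticNumber infinitePath k d c × + c ≡ ⌈ (d + 1) / (k ∸ 1) ⌉))
-- With `k = suc q`, fewer than `k` vertices means at most `q`, and `k ≥ 2` makes `q` a valid
-- divisor.
theorem4p4 d (suc q@(suc _)) n@(suc _) _ _ _ _ (s≤s (s≤s _)) =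
  pathGraph-chromaticNumber d q n , infinitePath-chromaticNumber d q
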